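{- Let $n>3$ be an integer and let $G=P_n$ be the path of order $n$. Then, for every $v\in V(G)$, $$IMC(v)=\begin{cases}\dfrac{2}{n+1}, & \text{if } v \text{ is an end-node of } P_n;\\[2mm] \dfrac{2(2n-1)}{n(n+1)}, & \text{otherwise.}\end{cases}$$
   Context: All graphs are finite, simple and undirected. The order of a graph is its number of nodes; $d_{uv}$ denotes the length of a shortest path between nodes $u$ and $v$; an end-node is a node of degree one. For a connected graph $H$ of order $m\ge 2$, the agglomeration is $$\phi(H)=\frac{m-1}{\sum_{u,v\in V(H),\,u\ne v} d_{uv}},$$ where the sum is over all ordered pairs $(u,v)$ of distinct nodes (equivalently $\phi(H)=1/(mL(H))$, where $L(H)=\frac{1}{m(m-1)}\sum_{u\neq v}d_{uv}$ is the average path length); if $m=1$, then $\phi(H)=1$. For a node $v$ of a graph $G$, the node contraction $G'(v)$ is the simple graph obtained from $G$ by replacing $v$ together with all its $\deg(v)$ neighbors (these $\deg(v)+1$ nodes) by one new node $v'$, which is adjacent to every remaining node that was adjacent in $G$ to at least one of the replaced nodes; adjacency among the remaining nodes is unchanged. The importance of $v$ in $G$ is $$IMC(v)=1-\frac{\phi(G)}{\phi(G'(v))}.$$ -}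

module Defs where

open import Data.Bool.Base using (if_then_else_)
open import Data.Empty using (⊥)
open import Data.Fin.Base using (Fin; zero; suc; toℕ)
open import Data.Fin.Properties using (_≟_; any?; injective⇒≤)
open import Data.Integer.Base using (+_)
open import Data.List.Base using (List; []; _∷_; length; filter; lookup; allFin)
open import Data.List.Membership.Propositional.Properties using (∈-lookup)
import Data.List.Relation.Unary.All as All
open import Data.List.Relation.Unary.AllPairs using ([]; _∷_)
open import Data.List.Relation.Unary.Unique.DecPropositional using (unique?)
open import Data.List.Relation.Unary.Unique.Propositional using (Unique)
open import Data.Nat.Base as ℕ using (ℕ; zero; suc; _≤_; _<_; z≤n; s≤s)
import Data.Nat.Properties as ℕ
open import Data.Product.Base using (Σ-syntax; ∃-syntax; _×_; _,_)
open import Data.Rational.Base as ℚ using (ℚ; 1ℚ; _/_; _÷_; _-_)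
import Data.Rational.Properties as ℚ
open import Data.Sum.Base using (_⊎_; inj₁; inj₂; swap)
open import Function.Base using (_∘_)
open import Level using (0ℓ)
open import Relation.Binary.Core using (Rel)
import Relation.Binary.Definitions as Binary
open import Relation.Binary.PropositionalEquality.Core
  using (_≡_; refl; sym; cong; subst)
open import Relation.Nullary.Decidable
  using (Dec; yes; no; does; ¬?; _×-dec_; _⊎-dec_; map′)
open import Relation.Nullary.Negation.Core using (¬_; contradiction)
open import Relation.Unary using (Pred; Decidable)

open import Algebra.Properties.CommutativeMonoid.Sum ℕ.+-0-commutativeMonoid
  using (sum-syntax)

private
  variable
    n : ℕ

record Graph (n : ℕ) : Set₁ where
  field
    Adj        : Rel (Fin n) 0ℓ
    adj?       : Binary.Decidable Adj
    adj-sym    : Binary.Symmetric Adj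
    adj-irrefl : ∀ {u} → ¬ Adj u u

open Graph public

degree : Graph n → Fin n → ℕ
degree {n} G v = length (filter (adj? G v) (allFin n))

EndNode : Graph n → Fin n → Set
EndNode G v = degree G v ≡ 1

infixr 5 _∷_

data Walk (G : Graph n) : Fin n → Fin n → ℕ → Set where
  []  : ∀ {u} → Walk G u u 0
  _∷_ : ∀ {u w v k} → Adj G u w → Walk G w v k → Walk G u v (suc k)

nodes : ∀ {G : Graph n} {u v k} → Walk G u v k → List (Fin n)
nodes {u = u} []      = u ∷ []
nodes {u = u} (_ ∷ p) = u ∷ nodes p

Path : Graph n → Fin n → Fin n → ℕ → Set
Path G u v k = Σ[ p ∈ Walk G u v k ] Unique (nodes p)

private
  walk? : (G : Graph n) {P : Pred (List (Fin n)) 0ℓ} → Decidable P →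
          ∀ u v k → Dec (Σ[ p ∈ Walk G u v k ] P (nodes p))
  walk? G {P} P? u v zero = map′ to from (u ≟ v ×-dec P? (u ∷ []))
    where
    to : u ≡ v × P (u ∷ []) → Σ[ p ∈ Walk G u v 0 ] P (nodes p)
    to (refl , q) = [] , q
    from : Σ[ p ∈ Walk G u v 0 ] P (nodes p) → u ≡ v × P (u ∷ [])
    from ([] , q) = refl , q
  walk? G {P} P? u v (suc k) =
    map′ to from (any? λ w → adj? G u w ×-dec walk? G (P? ∘ (u ∷_)) w v k)
    where
    Step : Set
    Step = ∃[ w ] Adj G u w × Σ[ p ∈ Walk G w v k ] P (u ∷ nodes p)
    to : Step → Σ[ p ∈ Walk G u v (suc k) ] P (nodes p)
    to (_ , a , p , q) = a ∷ p , q
    from : Σ[ p ∈ Walk G u v (suc k) ] P (nodes p) → Step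
    from (a ∷ p , q) = _ , a , p , q

path? : (G : Graph n) (u v : Fin n) → Decidable (Path G u v)
path? G = walk? G (unique? _≟_)

-- The least k < b satisfying P, or b if there is none.
least : {P : Pred ℕ 0ℓ} → Decidable P → ℕ → ℕ
least P? zero    = zero
least P? (suc b) = if does (P? 0) then 0 else suc (least (P? ∘ suc) b)

-- A path has fewer than n edges, so searching below n suffices
-- (dist-shortest); nodes joined by no path get the junk value n.
dist : Graph n → Fin n → Fin n → ℕ
dist {n} G u v = least (path? G u v) n

least-holds : {P : Pred ℕ 0ℓ} (P? : Decidable P) →
              ∀ {k b} → k < b → P k → P (least P? b)
least-holds P? {b = suc b} k<b pk with P? 0
... | yes p0 = p0
least-holds P? {zero}  {suc b} k<b       pk | no ¬p0 = contradiction pk ¬p0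
least-holds P? {suc k} {suc b} (s≤s k<b) pk | no _   =
  least-holds (P? ∘ suc) k<b pk

least-≤ : {P : Pred ℕ 0ℓ} (P? : Decidable P) →
          ∀ {k} b → P k → least P? b ≤ k
least-≤ P? zero    pk = z≤n
least-≤ P? (suc b) pk with P? 0
... | yes _ = z≤n
least-≤ P? {zero}  (suc b) pk | no ¬p0 = contradiction pk ¬p0
least-≤ P? {suc k} (suc b) pk | no _   = s≤s (least-≤ (P? ∘ suc) b pk)

private
  lookup-injective : ∀ {xs : List (Fin n)} → Unique xs →
                     ∀ {i j} → lookup xs i ≡ lookup xs j → i ≡ j
  lookup-injective {xs = _ ∷ xs} _ {zero} {zero} _ = refl
  lookup-injective {xs = _ ∷ xs} (x∉ ∷ _) {zero} {suc j} eq =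
    contradiction eq (All.lookup x∉ (∈-lookup j))
  lookup-injective {xs = _ ∷ xs} (x∉ ∷ _) {suc i} {zero} eq =
    contradiction (sym eq) (All.lookup x∉ (∈-lookup i))
  lookup-injective {xs = _ ∷ xs} (_ ∷ u) {suc i} {suc j} eq =
    cong suc (lookup-injective u eq)

  length-nodes : ∀ {G : Graph n} {u v k} (p : Walk G u v k) →
                 length (nodes p) ≡ suc k
  length-nodes []      = refl
  length-nodes (_ ∷ p) = cong suc (length-nodes p)

path-length< : ∀ {G : Graph n} {u v k} → Path G u v k → k < n
path-length< {n} (p , uniq) =
  subst (_≤ n) (length-nodes p) (injective⇒≤ (lookup-injective uniq))

dist-shortest : ∀ {G : Graph n} {u v k} → Path G u v k →
                Path G u v (dist G u v) × (∀ {l} → Path G u v l → dist G u v ≤ l)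
dist-shortest {n} {G} {u} {v} p =
  least-holds (path? G u v) (path-length< p) p , least-≤ (path? G u v) n

distanceSum : Graph n → ℕ
distanceSum {n} G = ∑[ u < n ] ∑[ v < n ] (if does (u ≟ v) then 0 else dist G u v)

-- The summand dist G zero (suc zero) computes to a successor.
distanceSum≢0 : (G : Graph (suc (suc n))) → ℕ.NonZero (distanceSum G)
distanceSum≢0 G = _

-- Meaningful only for connected graphs of positive order; order 0 gets a
-- junk value.
φ : Graph n → ℚ
φ {zero}        G = 1ℚ
φ {suc zero}    G = 1ℚ
φ {suc (suc n)} G = (+ suc n / distanceSum G) {{distanceSum≢0 G}}

φ≢0 : (G : Graph n) → ℚ.NonZero (φ G)
φ≢0 {zero}        G = _
φ≢0 {suc zero}    G = _
φ≢0 {suc (suc n)} G = ℚ.pos⇒nonZero (φ G)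
  {{ℚ.normalize-pos (suc n) (distanceSum G) {{distanceSum≢0 G}}}}

module _ (G : Graph n) (v : Fin n) where

  Replaced : Pred (Fin n) 0ℓ
  Replaced u = u ≡ v ⊎ Adj G v u

  replaced? : Decidable Replaced
  replaced? u = u ≟ v ⊎-dec adj? G v u

  remaining : List (Fin n)
  remaining = filter (¬? ∘ replaced?) (allFin n)

  -- Node zero is the new node v′; node suc i is the i-th remaining node of G.
  contract : Graph (suc (length remaining))
  contract = record
    { Adj        = Adj′
    ; adj?       = adj′?
    ; adj-sym    = λ {x} {y} → sym′ {x} {y}
    ; adj-irrefl = λ {x} → irrefl′ {x}
    }
    where
    JoinedToReplaced : Fin n → Set
    JoinedToReplaced u = ∃[ w ] Replaced w × Adj G w u

    joined? : Decidable JoinedToReplaced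
    joined? u = any? λ w → replaced? w ×-dec adj? G w u

    Adj′ : Rel (Fin (suc (length remaining))) 0ℓ
    Adj′ zero    zero    = ⊥
    Adj′ zero    (suc j) = JoinedToReplaced (lookup remaining j)
    Adj′ (suc i) zero    = JoinedToReplaced (lookup remaining i)
    Adj′ (suc i) (suc j) = Adj G (lookup remaining i) (lookup remaining j)

    adj′? : Binary.Decidable Adj′
    adj′? zero    zero    = no λ ()
    adj′? zero    (suc j) = joined? (lookup remaining j)
    adj′? (suc i) zero    = joined? (lookup remaining i)
    adj′? (suc i) (suc j) = adj? G (lookup remaining i) (lookup remaining j)

    sym′ : Binary.Symmetric Adj′
    sym′ {zero}  {suc j} a = a
    sym′ {suc i} {zero}  a = a
    sym′ {suc i} {suc j} a = adj-sym G a

    irrefl′ : ∀ {x} → ¬ Adj′ x x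
    irrefl′ {suc i} = adj-irrefl G

IMC : Graph n → Fin n → ℚ
IMC G v = 1ℚ - (φ G ÷ φ (contract G v)) {{φ≢0 (contract G v)}}

P[_] : ∀ n → Graph n
P[ n ] = record
  { Adj        = λ i j → suc (toℕ i) ≡ toℕ j ⊎ suc (toℕ j) ≡ toℕ i
  ; adj?       = λ i j → suc (toℕ i) ℕ.≟ toℕ j ⊎-dec suc (toℕ j) ℕ.≟ toℕ i
  ; adj-sym    = swap
  ; adj-irrefl = λ { (inj₁ eq) → ℕ.1+n≢n eq ; (inj₂ eq) → ℕ.1+n≢n eq }
  }

n[1+n]≢0 : 3 < n → ℕ.NonZero (n ℕ.* suc n)
n[1+n]≢0 (s≤s _) = _

{-# OPTIONS --safe #-}
-- Contracting a node of a path merges a block of consecutive nodes, so the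
-- contraction is again a path, of order m = n - 1 for an end-node and
-- m = n - 2 otherwise.  In a path the distance of two nodes is the difference
-- of their positions, and the sum of ∣ i - j ∣ over i, j < m is
-- (m - 1) m (m + 1) / 3.  Hence φ(P_m) = 3 / (m (m + 1)) for m ≥ 2, and the
-- importance is 1 - m (m + 1) / (n (n + 1)).
module Submission where

open import Defs
open import Data.Bool.Base using (if_then_else_)
open import Data.Fin.Base using (Fin; zero; suc; toℕ; fromℕ<; inject₁)
open import Data.Fin.Permutation as Permutation
  using (Permutation; _⟨$⟩ʳ_; _⟨$⟩ˡ_; inverseʳ; ↔⇒≡)
open import Data.Fin.Properties
  using (_≟_; toℕ-injective; toℕ-inject₁; toℕ<n; toℕ-fromℕ<)
open import Data.Integer.Base as ℤ using (+_)
import Data.Integer.Properties as ℤ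
open import Data.List.Base using (List; []; _∷_; length; lookup; allFin)
open import Data.List.Membership.Propositional using (_∈_)
open import Data.List.Membership.Propositional.Properties
  using (∈-filter⁺; ∈-filter⁻; ∈-allFin; ∈-lookup)
open import Data.List.Relation.Unary.All as All using (All; []; _∷_)
open import Data.List.Relation.Unary.All.Properties using (all-filter)
open import Data.List.Relation.Unary.AllPairs using ([]; _∷_)
open import Data.List.Relation.Unary.Any using (here; index)
open import Data.List.Relation.Unary.Any.Properties using (lookup-index)
open import Data.List.Relation.Unary.Unique.Propositional using (Unique)
open import Data.List.Relation.Unary.Unique.Propositional.Properties
  using (filter⁺; allFin⁺)
open import Data.Nat.Base hiding (_/_)
open import Data.Nat.Properties hiding (_≟_)
open import Data.Nat.Tactic.RingSolver using (solve-∀)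
open import Data.Product.Base using (Σ-syntax; ∃-syntax; _×_; _,_; proj₁; proj₂)
open import Data.Rational.Base as ℚ using (ℚ; 1ℚ; _/_; _÷_; fromℚᵘ; toℚᵘ)
import Data.Rational.Properties as ℚ
open import Data.Rational.Unnormalised.Base as ℚᵘ using (mkℚᵘ; *≡*)
import Data.Rational.Unnormalised.Properties as ℚᵘ
open import Data.Sum.Base as Sum using (_⊎_; inj₁; inj₂; swap; [_,_]′)
open import Function.Base using (id; _∘_; _$_)
open import Function.Bundles using (_⇔_; mk⇔; mk⤖; Equivalence; Injection)
open import Function.Consequences.Propositional using (strictlySurjective⇒surjective)
open import Function.Properties.Bijection using (⤖⇒↔)
open import Function.Properties.Inverse using (↔⇒↣)
open import Relation.Binary.Definitions using (tri<; tri≈; tri>)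
open import Relation.Binary.PropositionalEquality
  using ( _≡_; _≢_; refl; sym; trans; cong; cong₂; subst; subst₂; ≢-sym
        ; module ≡-Reasoning)
open import Relation.Nullary.Decidable using (yes; no; does; ¬?)
open import Relation.Nullary.Negation.Core using (¬_; contradiction)

open import Algebra.Properties.CommutativeMonoid.Sum +-0-commutativeMonoid
  using (sum-syntax; sum-cong-≗; sum-permute; ∑-distrib-+)

private
  variable
    m n k : ℕ
    A     : Set

-- Fractions

-- `_/_` reduces to lowest terms, so fractions are compared through their unnormalised forms, where
-- equality is cross-multiplication.
/-cross : ∀ p q r s .{{_ : NonZero q}} .{{_ : NonZero s}} →
          p * s ≡ r * q → + p / q ≡ + r / s
/-cross p (suc q) r (suc s) eq = ℚ.fromℚᵘ-cong {mkℚᵘ (+ p) q} {mkℚᵘ (+ r) s} $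
  *≡* (trans (sym (ℤ.pos-* p _)) (trans (cong +_ eq) (ℤ.pos-* r _)))

fromℚᵘ-homo-* : ∀ x y → fromℚᵘ (x ℚᵘ.* y) ≡ fromℚᵘ x ℚ.* fromℚᵘ y
fromℚᵘ-homo-* x y = ℚ.toℚᵘ-injective (begin
  toℚᵘ (fromℚᵘ (x ℚᵘ.* y))                 ≈⟨ ℚ.toℚᵘ-fromℚᵘ _ ⟩
  x ℚᵘ.* y                                 ≈⟨ ℚᵘ.*-cong (ℚ.toℚᵘ-fromℚᵘ x) (ℚ.toℚᵘ-fromℚᵘ y) ⟨
  toℚᵘ (fromℚᵘ x) ℚᵘ.* toℚᵘ (fromℚᵘ y)     ≈⟨ ℚ.toℚᵘ-homo-* (fromℚᵘ x) (fromℚᵘ y) ⟨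
  toℚᵘ (fromℚᵘ x ℚ.* fromℚᵘ y)             ∎)
  where open ℚᵘ.≃-Reasoning

fromℚᵘ-homo-+ : ∀ x y → fromℚᵘ (x ℚᵘ.+ y) ≡ fromℚᵘ x ℚ.+ fromℚᵘ y
fromℚᵘ-homo-+ x y = ℚ.toℚᵘ-injective (begin
  toℚᵘ (fromℚᵘ (x ℚᵘ.+ y))                 ≈⟨ ℚ.toℚᵘ-fromℚᵘ _ ⟩
  x ℚᵘ.+ y                                 ≈⟨ ℚᵘ.+-cong (ℚ.toℚᵘ-fromℚᵘ x) (ℚ.toℚᵘ-fromℚᵘ y) ⟨
  toℚᵘ (fromℚᵘ x) ℚᵘ.+ toℚᵘ (fromℚᵘ y)     ≈⟨ ℚ.toℚᵘ-homo-+ (fromℚᵘ x) (fromℚᵘ y) ⟨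
  toℚᵘ (fromℚᵘ x ℚ.+ fromℚᵘ y)             ∎)
  where open ℚᵘ.≃-Reasoning

/-*-/ : ∀ p q r s .{{_ : NonZero q}} .{{_ : NonZero s}} .{{_ : NonZero (q * s)}} →
        (+ p / q) ℚ.* (+ r / s) ≡ + (p * r) / (q * s)
/-*-/ p q@(suc q-1) r s@(suc s-1) = begin
  (+ p / q) ℚ.* (+ r / s)   ≡⟨ fromℚᵘ-homo-* (mkℚᵘ (+ p) q-1) (mkℚᵘ (+ r) s-1) ⟨
  (+ p ℤ.* + r) / (q * s)   ≡⟨ cong (_/ (q * s)) (ℤ.pos-* p r) ⟨
  + (p * r) / (q * s)       ∎
  where open ≡-Reasoning

/-+-/ : ∀ p q r s .{{_ : NonZero q}} .{{_ : NonZero s}} .{{_ : NonZero (q * s)}} →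
        (+ p / q) ℚ.+ (+ r / s) ≡ + (p * s + r * q) / (q * s)
/-+-/ p q@(suc q-1) r s@(suc s-1) = begin
  (+ p / q) ℚ.+ (+ r / s)
    ≡⟨ fromℚᵘ-homo-+ (mkℚᵘ (+ p) q-1) (mkℚᵘ (+ r) s-1) ⟨
  (+ p ℤ.* + s ℤ.+ + r ℤ.* + q) / (q * s)
    ≡⟨ cong (_/ (q * s)) (cong₂ ℤ._+_ (ℤ.pos-* p s) (ℤ.pos-* r q)) ⟨
  + (p * s + r * q) / (q * s) ∎
  where open ≡-Reasoning

-- The common numerator `c` cancels in the quotient, leaving `b / a`. The last hypothesis is
-- `p / q + b / a ≡ 1` cleared of denominators.
1-/÷/ : ∀ c a b p q .{{_ : NonZero a}} .{{_ : NonZero b}} .{{_ : NonZero q}}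
        {x y : ℚ} .{{_ : ℚ.NonZero y}} → x ≡ + c / a → y ≡ + c / b →
        p * a + b * q ≡ q * a → 1ℚ ℚ.- x ÷ y ≡ + p / q
1-/÷/ c a@(suc _) b@(suc _) p q@(suc _) {x} {y} refl refl eq = begin
  1ℚ ℚ.- x ÷ y                ≡⟨ cong (ℚ._-_ 1ℚ) x÷y ⟩
  1ℚ ℚ.- z                    ≡⟨ cong (ℚ._- z) t+z ⟨
  (t ℚ.+ z) ℚ.- z             ≡⟨ ℚ.+-assoc t z (ℚ.- z) ⟩
  t ℚ.+ (z ℚ.- z)             ≡⟨ cong (t ℚ.+_) (ℚ.+-inverseʳ z) ⟩
  t ℚ.+ ℚ.0ℚ                  ≡⟨ ℚ.+-identityʳ t ⟩
  t                           ∎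
  where
  open ≡-Reasoning
  z t : ℚ
  z = + b / a
  t = + p / q
  t+z : t ℚ.+ z ≡ 1ℚ
  t+z = trans (/-+-/ p q b a)
              (/-cross (p * a + b * q) (q * a) 1 1
                 (trans (*-identityʳ _) (trans eq (sym (*-identityˡ _)))))
  -- The quotient is found by multiplying back, so the reciprocal of `y` is never put in normal
  -- form.
  z*y : z ℚ.* y ≡ x
  z*y = trans (/-*-/ b a c b) (/-cross (b * c) (a * b) c a (lemma a b c))
    where
    lemma : ∀ a b c → b * c * a ≡ c * (a * b)
    lemma = solve-∀
  x÷y : x ÷ y ≡ z
  x÷y = begin
    x ℚ.* (ℚ.1/ y)             ≡⟨ cong (ℚ._* (ℚ.1/ y)) z*y ⟨
    (z ℚ.* y) ℚ.* (ℚ.1/ y)     ≡⟨ ℚ.*-assoc z y (ℚ.1/ y) ⟩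
    z ℚ.* (y ℚ.* (ℚ.1/ y))     ≡⟨ cong (z ℚ.*_) (ℚ.*-inverseʳ y) ⟩
    z ℚ.* 1ℚ                   ≡⟨ ℚ.*-identityʳ z ⟩
    z                          ∎

-- The agglomeration of a path

∑-suc : ∀ n (f : Fin n → ℕ) → ∑[ i < n ] suc (f i) ≡ n + ∑[ i < n ] f i
∑-suc zero    f = refl
∑-suc (suc n) f = cong suc (trans (cong (λ x → f zero + x) (∑-suc n (f ∘ suc))) (lemma (f zero) n _))
  where
  lemma : ∀ a n s → a + (n + s) ≡ n + (a + s)
  lemma = solve-∀

2*∑[1+i] : ∀ n → 2 * ∑[ i < n ] suc (toℕ i) ≡ n * suc n
2*∑[1+i] zero    = refl
2*∑[1+i] (suc n) = begin
  2 * suc (∑[ i < n ] suc (suc (toℕ i)))  ≡⟨ cong (λ s → 2 * suc s) (∑-suc n (suc ∘ toℕ)) ⟩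
  2 * suc (n + s)                         ≡⟨ lemma₁ n s ⟩
  2 + 2 * n + 2 * s                       ≡⟨ cong (λ x → 2 + 2 * n + x) (2*∑[1+i] n) ⟩
  2 + 2 * n + n * suc n                   ≡⟨ lemma₂ n ⟩
  suc n * suc (suc n)                     ∎
  where
  open ≡-Reasoning
  s = ∑[ i < n ] suc (toℕ i)
  lemma₁ : ∀ n s → 2 * suc (n + s) ≡ 2 + 2 * n + 2 * s
  lemma₁ = solve-∀
  lemma₂ : ∀ n → 2 + 2 * n + n * suc n ≡ suc n * suc (suc n)
  lemma₂ = solve-∀

-- Induction by removing node 0: its row and its column each contribute the triangular sum `s`, and
-- the remaining square is the sum `t` of the shorter path. The factor 3 avoids division.
3*∑∑∣i-j∣ : ∀ n → 3 * ∑[ i < suc n ] ∑[ j < suc n ] ∣ toℕ i - toℕ j ∣ ≡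
            n * suc n * suc (suc n)
3*∑∑∣i-j∣ zero    = refl
3*∑∑∣i-j∣ (suc n) = begin
  3 * (s + ∑[ i < suc n ] (suc (toℕ i) + ∑[ j < suc n ] ∣ toℕ i - toℕ j ∣))
    ≡⟨ cong (λ x → 3 * (s + x)) (∑-distrib-+ {suc n} (suc ∘ toℕ)
          (λ i → ∑[ j < suc n ] ∣ toℕ i - toℕ j ∣)) ⟩
  3 * (s + (s + t))                              ≡⟨ lemma₁ s t ⟩
  3 * (2 * s) + 3 * t
    ≡⟨ cong₂ (λ x y → 3 * x + y) (2*∑[1+i] (suc n)) (3*∑∑∣i-j∣ n) ⟩
  3 * (suc n * suc (suc n)) + n * suc n * suc (suc n) ≡⟨ lemma₂ n ⟩
  suc n * suc (suc n) * suc (suc (suc n))        ∎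
  where
  open ≡-Reasoning
  s = ∑[ i < suc n ] suc (toℕ i)
  t = ∑[ i < suc n ] ∑[ j < suc n ] ∣ toℕ i - toℕ j ∣
  lemma₁ : ∀ s t → 3 * (s + (s + t)) ≡ 3 * (2 * s) + 3 * t
  lemma₁ = solve-∀
  lemma₂ : ∀ n → 3 * (suc n * suc (suc n)) + n * suc n * suc (suc n) ≡
               suc n * suc (suc n) * suc (suc (suc n))
  lemma₂ = solve-∀

-- Distances in a graph isomorphic to a path

-- The contraction puts its new node at zero, so it is in general a path only up to relabelling.
record _≅_ (G : Graph n) (H : Graph m) : Set where
  field
    nodes↔ : Permutation n m
    adj⇔   : ∀ u v → Adj G u v ⇔ Adj H (nodes↔ ⟨$⟩ʳ u) (nodes↔ ⟨$⟩ʳ v)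

≅-refl : {G : Graph n} → G ≅ G
≅-refl = record { nodes↔ = Permutation.id ; adj⇔ = λ _ _ → mk⇔ id id }

P-adj⇒∣i-j∣≡1 : (i j : Fin n) → Adj P[ n ] i j → ∣ toℕ i - toℕ j ∣ ≡ 1
P-adj⇒∣i-j∣≡1 i j (inj₁ eq) = begin
  ∣ toℕ i - toℕ j ∣       ≡⟨ cong ∣ toℕ i -_∣ eq ⟨
  ∣ toℕ i - suc (toℕ i) ∣ ≡⟨ cong ∣ toℕ i -_∣ (+-comm 1 (toℕ i)) ⟩
  ∣ toℕ i - toℕ i + 1 ∣   ≡⟨ ∣m-m+n∣≡n (toℕ i) 1 ⟩
  1                       ∎
  where open ≡-Reasoning
P-adj⇒∣i-j∣≡1 i j (inj₂ eq) =
  trans (∣-∣-comm (toℕ i) (toℕ j)) (P-adj⇒∣i-j∣≡1 j i (inj₁ eq))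

-- Common successors are stripped until one of the two nodes is zero, which forces the direction of
-- the step.
closer : (i j : Fin n) → ∣ toℕ i - toℕ j ∣ ≡ suc k →
         ∃[ l ] Adj P[ n ] i l × ∣ toℕ l - toℕ j ∣ ≡ k
closer zero    (suc zero)    eq = suc zero , inj₁ refl , suc-injective eq
closer zero    (suc (suc j)) eq = suc zero , inj₁ refl , suc-injective eq
closer (suc i) zero          eq =
  inject₁ i , inj₂ (cong suc (toℕ-inject₁ i)) ,
  trans (∣-∣-identityʳ _) (trans (toℕ-inject₁ i) (suc-injective eq))
closer (suc i) (suc j)       eq with l , a , eq′ ← closer i j eq =
  suc l , Sum.map (cong suc) (cong suc) a , eq′

module _ {G : Graph n} (iso : G ≅ P[ m ]) where
  open _≅_ iso

  private
    pos : Fin n → ℕ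
    pos u = toℕ (nodes↔ ⟨$⟩ʳ u)

    pos-injective : ∀ {u v} → pos u ≡ pos v → u ≡ v
    pos-injective = Injection.injective (↔⇒↣ nodes↔) ∘ toℕ-injective

    gap : Fin n → Fin n → ℕ
    gap u v = ∣ pos u - pos v ∣

    -- Each edge changes the position by exactly one, so the triangle inequality bounds the gap
    -- along a walk.
    gap≤length : ∀ {u v} → Walk G u v k → gap u v ≤ k
    gap≤length {u = u}  []      = ≤-reflexive (m≡n⇒∣m-n∣≡0 {pos u} refl)
    gap≤length {u = u} {v} (_∷_ {w = w} {k = k} a p) = begin
      gap u v            ≤⟨ ∣-∣-triangle (pos u) (pos w) (pos v) ⟩
      gap u w + gap w v  ≤⟨ +-mono-≤ (≤-reflexive (P-adj⇒∣i-j∣≡1 _ _ (Equivalence.to (adj⇔ u w) a)))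
                                     (gap≤length p) ⟩
      suc k              ∎
      where open ≤-Reasoning

    gap-step : ∀ u v → gap u v ≡ suc k → ∃[ w ] Adj G u w × gap w v ≡ k
    gap-step u v eq
      with l , a , eq′ ← closer (nodes↔ ⟨$⟩ʳ u) (nodes↔ ⟨$⟩ʳ v) eq =
      nodes↔ ⟨$⟩ˡ l ,
      Equivalence.from (adj⇔ _ _) (subst (Adj P[ m ] (nodes↔ ⟨$⟩ʳ u)) (sym (inverseʳ nodes↔)) a) ,
      trans (cong (λ i → ∣ toℕ i - pos v ∣) (inverseʳ nodes↔)) eq′

    -- The bound on all nodes strengthens the induction: the tail stays within `k` of `v` while `u`
    -- is at `suc k`, so `u` does not recur.
    gap-path : ∀ k u v → gap u v ≡ k →
               Σ[ p ∈ Walk G u v k ] Unique (nodes p) × All (λ w → gap w v ≤ k) (nodes p)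
    gap-path zero u v eq with refl ← pos-injective (∣m-n∣≡0⇒m≡n eq) =
      [] , [] ∷ [] , ≤-reflexive eq ∷ []
    gap-path (suc k) u v eq
      with w , a , eq′ ← gap-step u v eq
      with p , uniq , near ← gap-path k w v eq′ =
      a ∷ p ,
      All.map (λ { le refl → 1+n≰n (subst (_≤ k) eq le) }) near ∷ uniq ,
      ≤-reflexive eq ∷ All.map m≤n⇒m≤1+n near

  -- `gap-path` bounds the distance from above; `gap≤length`, applied to a shortest path, bounds it
  -- from below.
  ≅P⇒dist : ∀ u v → dist G u v ≡ ∣ toℕ (nodes↔ ⟨$⟩ʳ u) - toℕ (nodes↔ ⟨$⟩ʳ v) ∣
  ≅P⇒dist u v with p , uniq , _ ← gap-path (gap u v) u v refl
               with q , shortest ← dist-shortest (p , uniq) =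
    ≤-antisym (shortest (p , uniq)) (gap≤length (proj₁ q))

  ≅P⇒distanceSum : distanceSum G ≡ ∑[ i < m ] ∑[ j < m ] ∣ toℕ i - toℕ j ∣
  ≅P⇒distanceSum = begin
    distanceSum G
      ≡⟨ sum-cong-≗ (λ u → sum-cong-≗ (summand u)) ⟩
    ∑[ u < n ] ∑[ v < n ] gap u v
      ≡⟨ sum-cong-≗ (λ u → sum-permute (λ j → ∣ pos u - toℕ j ∣) nodes↔) ⟨
    ∑[ u < n ] ∑[ j < m ] ∣ pos u - toℕ j ∣
      ≡⟨ sum-permute (λ i → ∑[ j < m ] ∣ toℕ i - toℕ j ∣) nodes↔ ⟨
    ∑[ i < m ] ∑[ j < m ] ∣ toℕ i - toℕ j ∣ ∎
    where
    open ≡-Reasoning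
    -- The diagonal, left out of `distanceSum`, has gap zero and may be included.
    summand : ∀ u v → (if does (u ≟ v) then 0 else dist G u v) ≡ gap u v
    summand u v with u ≟ v
    ... | yes refl = sym (m≡n⇒∣m-n∣≡0 {pos u} refl)
    ... | no  _    = ≅P⇒dist u v

-- The numerator `m - 1` cancels against the same factor of the distance sum. For `m = 1` the
-- convention gives 1, which differs from this formula.
≅P⇒φ : {G : Graph n} → G ≅ P[ m ] → 2 ≤ m → .{{_ : NonZero (m * suc m)}} →
       φ G ≡ + 3 / (m * suc m)
≅P⇒φ {G = G} iso 2≤m with refl ← ↔⇒≡ (_≅_.nodes↔ iso) = go G iso 2≤m
  where
  go : (G : Graph m) → G ≅ P[ m ] → 2 ≤ m → .{{_ : NonZero (m * suc m)}} →
       φ G ≡ + 3 / (m * suc m)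
  go {m = suc (suc k)} G iso _ = /-cross (suc k) (distanceSum G) 3 _ {{distanceSum≢0 G}} (begin
    suc k * (suc (suc k) * suc (suc (suc k)))  ≡⟨ *-assoc (suc k) (suc (suc k)) (suc (suc (suc k))) ⟨
    suc k * suc (suc k) * suc (suc (suc k))    ≡⟨ 3*∑∑∣i-j∣ (suc k) ⟨
    3 * (∑[ i < suc (suc k) ] ∑[ j < suc (suc k) ] ∣ toℕ i - toℕ j ∣)
                                               ≡⟨ cong (3 *_) (≅P⇒distanceSum iso) ⟨
    3 * distanceSum G                          ∎)
    where open ≡-Reasoning
  go {m = suc zero} _ _ (s≤s ())

-- Contracting a block of a path

lookup-injective : {xs : List A} → Unique xs → ∀ {i j} → lookup xs i ≡ lookup xs j → i ≡ j
lookup-injective (_ ∷ _)  {zero}  {zero}  _  = refl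
lookup-injective {xs = _ ∷ xs} (x∉ ∷ _) {zero} {suc j} eq =
  contradiction eq (All.lookup x∉ (∈-lookup j))
lookup-injective {xs = _ ∷ xs} (x∉ ∷ _) {suc i} {zero} eq =
  contradiction (sym eq) (All.lookup x∉ (∈-lookup i))
lookup-injective (_ ∷ u)  {suc i} {suc j} eq = cong suc (lookup-injective u eq)

-- Merging the block a, …, a + w into a shifts the numbers above it down by w.
module Collapse (a w : ℕ) where

  Outside : ℕ → Set
  Outside x = x < a ⊎ a + w < x

  -- The first term stops growing at `a` and the second starts after `a + w`: the identity below the
  -- block, constantly `a` on it, a shift by `w` above it.
  collapse : ℕ → ℕ
  collapse x = x ⊓ a + (x ∸ (a + w))

  collapse-below : ∀ {x} → x < a → collapse x ≡ x
  collapse-below {x} x<a = begin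
    x ⊓ a + (x ∸ (a + w))  ≡⟨ cong₂ _+_ (m≤n⇒m⊓n≡m (<⇒≤ x<a))
                                        (m≤n⇒m∸n≡0 (m≤n⇒m≤n+o w (<⇒≤ x<a))) ⟩
    x + 0                  ≡⟨ +-identityʳ x ⟩
    x                      ∎
    where open ≡-Reasoning

  -- Adding `w` back, instead of subtracting it from `x`, lets later comparisons go by cancellation.
  collapse-above : ∀ {x} → a + w < x → collapse x + w ≡ x
  collapse-above {x} a+w<x = begin
    x ⊓ a + (x ∸ (a + w)) + w
      ≡⟨ cong (λ y → y + (x ∸ (a + w)) + w) (m≥n⇒m⊓n≡n (m+n≤o⇒m≤o a (<⇒≤ a+w<x))) ⟩
    a + (x ∸ (a + w)) + w      ≡⟨ +-assoc a _ w ⟩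
    a + (x ∸ (a + w) + w)      ≡⟨ cong (λ y → a + y) (+-comm _ w) ⟩
    a + (w + (x ∸ (a + w)))    ≡⟨ +-assoc a w _ ⟨
    a + w + (x ∸ (a + w))      ≡⟨ m+[n∸m]≡n (<⇒≤ a+w<x) ⟩
    x                          ∎
    where open ≡-Reasoning

  a<collapse : ∀ {x} → a + w < x → a < collapse x
  a<collapse a+w<x = +-cancelʳ-< w a _ (subst (a + w <_) (sym (collapse-above a+w<x)) a+w<x)

  collapse≢a : ∀ {x} → Outside x → a ≢ collapse x
  collapse≢a (inj₁ x<a)   eq = <⇒≢ x<a (trans (sym (collapse-below x<a)) (sym eq))
  collapse≢a (inj₂ a+w<x) eq = <⇒≢ (a<collapse a+w<x) eq

  collapse-< : ∀ {x m} → a < m → Outside x → x < m + w → collapse x < m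
  collapse-< a<m (inj₁ x<a)   _     = subst (_< _) (sym (collapse-below x<a)) (<-trans x<a a<m)
  collapse-< a<m (inj₂ a+w<x) x<m+w =
    +-cancelʳ-< w _ _ (subst (_< _) (sym (collapse-above a+w<x)) x<m+w)

  below<above : ∀ {x y} → x < a → a + w < y → collapse x < collapse y
  below<above x<a a+w<y = subst (_< _) (sym (collapse-below x<a)) (<-trans x<a (a<collapse a+w<y))

  collapse-injective : ∀ {x y} → Outside x → Outside y → collapse x ≡ collapse y → x ≡ y
  collapse-injective (inj₁ x<) (inj₁ y<) eq =
    trans (sym (collapse-below x<)) (trans eq (collapse-below y<))
  collapse-injective (inj₁ x<) (inj₂ y>) eq = contradiction eq (<⇒≢ (below<above x< y>))
  collapse-injective (inj₂ x>) (inj₁ y<) eq = contradiction (sym eq) (<⇒≢ (below<above y< x>))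
  collapse-injective (inj₂ x>) (inj₂ y>) eq =
    trans (sym (collapse-above x>)) (trans (cong (_+ w) eq) (collapse-above y>))

  -- Consecutive numbers outside the block lie on the same side, because the block contains `a`; on
  -- either side `collapse` is a translation.
  collapse-suc⁺ : ∀ {x y} → Outside x → Outside y → suc x ≡ y → suc (collapse x) ≡ collapse y
  collapse-suc⁺ (inj₁ x<) (inj₁ y<) eq =
    trans (cong suc (collapse-below x<)) (trans eq (sym (collapse-below y<)))
  collapse-suc⁺ (inj₁ x<) (inj₂ y>) refl = contradiction (m≤n⇒m≤n+o w x<) (<⇒≱ y>)
  collapse-suc⁺ (inj₂ x>) (inj₁ y<) refl = contradiction (<-trans (m≤n⇒m≤1+n x>) y<) (m+n≮m a w)
  collapse-suc⁺ (inj₂ x>) (inj₂ y>) eq = +-cancelʳ-≡ w _ _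
    (trans (cong suc (collapse-above x>)) (trans eq (sym (collapse-above y>))))

  -- Images from opposite sides have `a` strictly between them, so they are not consecutive.
  collapse-suc⁻ : ∀ {x y} → Outside x → Outside y → suc (collapse x) ≡ collapse y → suc x ≡ y
  collapse-suc⁻ (inj₁ x<) (inj₁ y<) eq =
    trans (cong suc (sym (collapse-below x<))) (trans eq (collapse-below y<))
  collapse-suc⁻ (inj₁ x<) (inj₂ y>) eq = contradiction
    (subst (_≤ a) (trans (cong suc (sym (collapse-below x<))) eq) x<) (<⇒≱ (a<collapse y>))
  collapse-suc⁻ (inj₂ x>) (inj₁ y<) eq = contradiction (sym eq) (<⇒≢ (m<n⇒m<1+n (below<above y< x>)))
  collapse-suc⁻ (inj₂ x>) (inj₂ y>) eq =
    trans (cong suc (sym (collapse-above x>))) (trans (cong (_+ w) eq) (collapse-above y>))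

-- The contraction is studied through this interval alone, so end-nodes and interior nodes share one
-- proof.
Block : ∀ {n} → Fin n → ℕ → ℕ → Set
Block {n} v a w = ∀ u → Replaced P[ n ] v u ⇔ (a ≤ toℕ u × toℕ u ≤ a + w)

-- Merging `w + 1` nodes into one loses `w` nodes, and `a < m` says that the whole block fits in the
-- path, since then `a + w < n`.
module _ {n m a w : ℕ} (v : Fin n) (n≡m+w : n ≡ m + w) (a<m : a < m)
         (replaced⇔ : Block v a w) where
  open Collapse a w

  private
    G : Graph n
    G = P[ n ]

    rest : List (Fin n)
    rest = remaining G v

    ¬replaced? = λ u → ¬? (replaced? G v u)

    node : Fin (length rest) → ℕ
    node i = toℕ (lookup rest i)

    node-outside : ∀ i → Outside (node i)
    node-outside i with node i <? a | a + w <? node i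
    ... | yes x<a | _         = inj₁ x<a
    ... | no _    | yes a+w<x = inj₂ a+w<x
    ... | no x≮a  | no a+w≮x  = contradiction
      (Equivalence.from (replaced⇔ _) (≮⇒≥ x≮a , ≮⇒≥ a+w≮x))
      (proj₂ (∈-filter⁻ ¬replaced? {xs = allFin n} (∈-lookup i)))

    outside-node : ∀ {x} → x < n → Outside x → ∃[ i ] node i ≡ x
    outside-node {x} x<n out =
      index u∈rest , trans (cong toℕ (sym (lookup-index u∈rest))) (toℕ-fromℕ< x<n)
      where
      u : Fin n
      u = fromℕ< x<n
      ¬inside : Outside x → ¬ (a ≤ x × x ≤ a + w)
      ¬inside (inj₁ x<a)   (a≤x , _)   = <⇒≱ x<a a≤x
      ¬inside (inj₂ a+w<x) (_ , x≤a+w) = <⇒≱ a+w<x x≤a+w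
      u∈rest : u ∈ rest
      u∈rest = ∈-filter⁺ ¬replaced? (∈-allFin u)
        (subst (λ y → ¬ (a ≤ y × y ≤ a + w)) (sym (toℕ-fromℕ< x<n)) (¬inside out)
         ∘ Equivalence.to (replaced⇔ u))

    -- The new node takes the one position that `collapse` gives to no remaining node.
    pos : Fin (suc (length rest)) → ℕ
    pos zero    = a
    pos (suc i) = collapse (node i)

    pos<m : ∀ x → pos x < m
    pos<m zero    = a<m
    pos<m (suc i) = collapse-< a<m (node-outside i) (subst (node i <_) n≡m+w (toℕ<n (lookup rest i)))

    pos-injective : ∀ x y → pos x ≡ pos y → x ≡ y
    pos-injective zero    zero    _  = refl
    pos-injective zero    (suc j) eq = contradiction eq (collapse≢a (node-outside j))
    pos-injective (suc i) zero    eq = contradiction (sym eq) (collapse≢a (node-outside i))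
    pos-injective (suc i) (suc j) eq = cong suc $
      lookup-injective (filter⁺ ¬replaced? (allFin⁺ n)) $ toℕ-injective $
      collapse-injective (node-outside i) (node-outside j) eq

    pos-surjective : ∀ {p} → p < m → ∃[ x ] pos x ≡ p
    pos-surjective {p} p<m with <-cmp p a
    ... | tri< p<a _ _
        with i , eq ← outside-node (subst (p <_) (sym n≡m+w) (m≤n⇒m≤n+o w p<m)) (inj₁ p<a) =
      suc i , trans (cong collapse eq) (collapse-below p<a)
    ... | tri≈ _ p≡a _ = zero , sym p≡a
    -- The preimage is the remaining node numbered `p + w`, which undoes the shift.
    ... | tri> _ _ a<p
        with i , eq ← outside-node (subst (p + w <_) (sym n≡m+w) (+-monoˡ-< w p<m))
                                  (inj₂ (+-monoˡ-< w a<p)) =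
      suc i , trans (cong collapse eq) (+-cancelʳ-≡ w _ _ (collapse-above (+-monoˡ-< w a<p)))

    place : Fin (suc (length rest)) → Fin m
    place x = fromℕ< (pos<m x)

    toℕ-place : ∀ x → toℕ (place x) ≡ pos x
    toℕ-place x = toℕ-fromℕ< (pos<m x)

    -- This also fixes the order of the contraction, with no separate count of the filtered list.
    place↔ : Permutation (suc (length rest)) m
    place↔ = ⤖⇒↔ (mk⤖ (injective , strictlySurjective⇒surjective surjective))
      where
      injective : ∀ {x y} → place x ≡ place y → x ≡ y
      injective {x} {y} eq = pos-injective x y
        (trans (sym (toℕ-place x)) (trans (cong toℕ eq) (toℕ-place y)))
      surjective : ∀ i → ∃[ x ] place x ≡ i
      surjective i with x , eq ← pos-surjective (toℕ<n i) =
        x , toℕ-injective (trans (toℕ-place x) eq)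

    Near : ℕ → ℕ → Set
    Near x y = suc x ≡ y ⊎ suc y ≡ x

    -- An outside node adjacent to the block is numbered `a - 1` or `a + w + 1`; the latter
    -- collapses to `a + 1`.
    joined⁺ : ∀ i → Adj (contract G v) zero (suc i) → Near a (collapse (node i))
    joined⁺ i (z , r , adj)
      with node i | node-outside i | Equivalence.to (replaced⇔ z) r | adj
    ... | x | inj₁ x<a | a≤z , _ | inj₁ refl = contradiction (m≤n⇒m≤1+n a≤z) (<⇒≱ x<a)
    ... | x | inj₁ x<a | a≤z , _ | inj₂ 1+x≡z = inj₂
      (trans (cong suc (collapse-below x<a)) (≤-antisym x<a (subst (a ≤_) (sym 1+x≡z) a≤z)))
    ... | x | inj₂ a+w<x | _ , z≤a+w | inj₁ refl = inj₁ (+-cancelʳ-≡ w _ _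
      (trans (≤-antisym a+w<x (s≤s z≤a+w)) (sym (collapse-above a+w<x))))
    ... | x | inj₂ a+w<x | _ , z≤a+w | inj₂ 1+x≡z =
      contradiction (≤-trans (≤-reflexive 1+x≡z) z≤a+w) (<⇒≱ (m≤n⇒m≤1+n a+w<x))

    joined-by : ∀ {x z} → a ≤ z → z ≤ a + w → Near z x →
                Σ[ u ∈ Fin n ] Replaced G v u × Near (toℕ u) x
    joined-by {x} {z} a≤z z≤a+w near =
      fromℕ< z<n ,
      Equivalence.from (replaced⇔ _)
        (subst (λ y → a ≤ y × y ≤ a + w) (sym (toℕ-fromℕ< z<n)) (a≤z , z≤a+w)) ,
      subst (λ y → Near y x) (sym (toℕ-fromℕ< z<n)) near
      where
      z<n : z < n
      z<n = subst (z <_) (sym n≡m+w) (≤-<-trans z≤a+w (+-monoˡ-< w a<m))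

    -- The replaced neighbour is the first node of the block for a node below it, and the last one,
    -- `a + w`, for a node above it.
    joined⁻ : ∀ i → Near a (collapse (node i)) → Adj (contract G v) zero (suc i)
    joined⁻ i near with node i | node-outside i | near
    ... | x | inj₁ x<a | inj₁ eq =
      contradiction (≤-reflexive (trans eq (collapse-below x<a))) (<⇒≱ (m≤n⇒m≤1+n x<a))
    ... | x | inj₁ x<a | inj₂ eq = joined-by ≤-refl (m≤m+n a w)
      (inj₂ (trans (cong suc (sym (collapse-below x<a))) eq))
    ... | x | inj₂ a+w<x | inj₁ eq = joined-by (m≤m+n a w) ≤-refl
      (inj₁ (trans (cong (_+ w) eq) (collapse-above a+w<x)))
    ... | x | inj₂ a+w<x | inj₂ eq =
      contradiction (≤-reflexive eq) (<⇒≱ (m≤n⇒m≤1+n (a<collapse a+w<x)))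

    pos-adj⁺ : ∀ x y → Adj (contract G v) x y → Near (pos x) (pos y)
    pos-adj⁺ zero    (suc j) = joined⁺ j
    pos-adj⁺ (suc i) zero    = swap ∘ joined⁺ i
    pos-adj⁺ (suc i) (suc j) = Sum.map (collapse-suc⁺ (node-outside i) (node-outside j))
                                       (collapse-suc⁺ (node-outside j) (node-outside i))

    pos-adj⁻ : ∀ x y → Near (pos x) (pos y) → Adj (contract G v) x y
    pos-adj⁻ zero    zero    (inj₁ eq) = contradiction eq 1+n≢n
    pos-adj⁻ zero    zero    (inj₂ eq) = contradiction eq 1+n≢n
    pos-adj⁻ zero    (suc j) = joined⁻ j
    pos-adj⁻ (suc i) zero    = joined⁻ i ∘ swap
    pos-adj⁻ (suc i) (suc j) = Sum.map (collapse-suc⁻ (node-outside i) (node-outside j))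
                                       (collapse-suc⁻ (node-outside j) (node-outside i))

  contract-P≅P : contract P[ n ] v ≅ P[ m ]
  contract-P≅P = record
    { nodes↔ = place↔
    ; adj⇔   = λ x y → mk⇔
        (subst₂ Near (sym (toℕ-place x)) (sym (toℕ-place y)) ∘ pos-adj⁺ x y)
        (pos-adj⁻ x y ∘ subst₂ Near (toℕ-place x) (toℕ-place y))
    }

-- End-nodes and interior nodes

-- A degree is the length of a filtered list; this and its converse reduce degree one to membership.
length≡1⁺ : ∀ {x : A} {xs} → Unique xs → x ∈ xs → All (_≡ x) xs → length xs ≡ 1
length≡1⁺ {xs = _ ∷ []}    _                 _ _                 = refl
length≡1⁺ {xs = _ ∷ _ ∷ _} ((x≢y ∷ _) ∷ _) _ (refl ∷ refl ∷ _) = contradiction refl x≢y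

length≡1⁻ : ∀ {x y : A} {xs} → length xs ≡ 1 → x ∈ xs → y ∈ xs → x ≡ y
length≡1⁻ {xs = _ ∷ []} _ (here refl) (here refl) = refl

module _ (G : Graph n) (v : Fin n) where

  one-neighbour⇒EndNode : ∀ {w} → Adj G v w → (∀ {u} → Adj G v u → u ≡ w) → EndNode G v
  one-neighbour⇒EndNode adj only = length≡1⁺
    (filter⁺ (adj? G v) (allFin⁺ n))
    (∈-filter⁺ (adj? G v) (∈-allFin _) adj)
    (All.map only (all-filter (adj? G v) (allFin n)))

  two-neighbours⇒¬EndNode : ∀ {x y} → Adj G v x → Adj G v y → x ≢ y → ¬ EndNode G v
  two-neighbours⇒¬EndNode adj₁ adj₂ x≢y end = x≢y $ length≡1⁻ end
    (∈-filter⁺ (adj? G v) (∈-allFin _) adj₁) (∈-filter⁺ (adj? G v) (∈-allFin _) adj₂)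

first-EndNode : ∀ {n} (v : Fin (suc (suc n))) → toℕ v ≡ 0 → EndNode P[ suc (suc n) ] v
first-EndNode {n} zero _ = one-neighbour⇒EndNode P[ suc (suc n) ] zero {suc zero} (inj₁ refl)
  λ { (inj₁ 1≡u) → toℕ-injective (sym 1≡u) }

last-EndNode : (v : Fin n) → toℕ v ≡ suc k → n ≡ suc (suc k) → EndNode P[ n ] v
last-EndNode {k = k} v v≡1+k refl = one-neighbour⇒EndNode P[ _ ] v
  (inj₂ (trans (cong suc k′≡k) (sym v≡1+k)))
  -- An upper neighbour would be numbered `n`, out of range.
  λ { {u} (inj₁ 1+v≡u) →
        contradiction (trans (cong suc (sym v≡1+k)) 1+v≡u) (≢-sym (<⇒≢ (toℕ<n u)))
    ; (inj₂ 1+u≡v) → toℕ-injective (trans (suc-injective (trans 1+u≡v v≡1+k)) (sym k′≡k)) }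
  where
  k′≡k : toℕ (fromℕ< (m<n⇒m<1+n (n<1+n k))) ≡ k
  k′≡k = toℕ-fromℕ< _

interior-¬EndNode : (v : Fin n) → toℕ v ≡ suc k → suc (suc k) < n → ¬ EndNode P[ n ] v
interior-¬EndNode {n} {k} v v≡1+k 2+k<n = two-neighbours⇒¬EndNode P[ _ ] v
  (inj₂ (trans (cong suc (toℕ-fromℕ< k<n)) (sym v≡1+k)))
  (inj₁ (trans (cong suc v≡1+k) (sym (toℕ-fromℕ< 2+k<n))))
  λ eq → <⇒≢ (m<n⇒m<1+n (n<1+n k))
    (trans (sym (toℕ-fromℕ< k<n)) (trans (cong toℕ eq) (toℕ-fromℕ< 2+k<n)))
  where
  k<n : k < n
  k<n = <-trans (m<n⇒m<1+n (n<1+n k)) 2+k<n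

-- Positions on the path and the blocks they replace

-- The index `k` is the number of the lower neighbour of `v`, where the block begins unless `v` is
-- first.
data Position {n} (v : Fin n) : Set where
  first    : toℕ v ≡ 0 → Position v
  last     : toℕ v ≡ suc k → n ≡ suc (suc k) → Position v
  interior : toℕ v ≡ suc k → suc (suc k) < n → Position v

position : (v : Fin n) → Position v
position v with toℕ v in v≡ | toℕ<n v
... | zero  | _ = first v≡
... | suc k | 1+k<n with m≤n⇒m<n∨m≡n 1+k<n
...   | inj₁ 2+k<n = interior v≡ 2+k<n
...   | inj₂ 2+k≡n = last v≡ (sym 2+k≡n)

first-block : (v : Fin n) → toℕ v ≡ 0 → Block v 0 1
first-block v v≡0 u = mk⇔ to from
  where
  to : Replaced P[ _ ] v u → 0 ≤ toℕ u × toℕ u ≤ 1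
  to (inj₁ refl)         = z≤n , ≤-trans (≤-reflexive v≡0) z≤n
  to (inj₂ (inj₁ 1+v≡u)) = z≤n , ≤-reflexive (trans (sym 1+v≡u) (cong suc v≡0))
  to (inj₂ (inj₂ 1+u≡v)) = contradiction (trans 1+u≡v v≡0) 1+n≢0
  from : 0 ≤ toℕ u × toℕ u ≤ 1 → Replaced P[ _ ] v u
  from (_ , u≤1) with m≤n⇒m<n∨m≡n u≤1
  ... | inj₁ u<1 = inj₁ (toℕ-injective (trans (n<1⇒n≡0 u<1) (sym v≡0)))
  ... | inj₂ u≡1 = inj₂ (inj₁ (trans (cong suc v≡0) (sym u≡1)))

interior-block : (v : Fin n) → toℕ v ≡ suc k → Block v k 2
interior-block {k = k} v v≡1+k u = mk⇔ to from
  where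
  k+2 : k + 2 ≡ suc (suc k)
  k+2 = +-comm k 2
  to : Replaced P[ _ ] v u → k ≤ toℕ u × toℕ u ≤ k + 2
  to (inj₁ refl) =
    subst (k ≤_) (sym v≡1+k) (n≤1+n k) ,
    subst₂ _≤_ (sym v≡1+k) (sym k+2) (n≤1+n (suc k))
  to (inj₂ (inj₁ 1+v≡u)) rewrite sym 1+v≡u | v≡1+k = m≤n⇒m≤1+n (n≤1+n k) , ≤-reflexive (sym k+2)
  to (inj₂ (inj₂ 1+u≡v)) with refl ← suc-injective (trans 1+u≡v v≡1+k) = ≤-refl , m≤m+n _ 2
  from : k ≤ toℕ u × toℕ u ≤ k + 2 → Replaced P[ _ ] v u
  from (k≤u , u≤k+2) with m≤n⇒m<n∨m≡n k≤u | m≤n⇒m<n∨m≡n (subst (toℕ u ≤_) k+2 u≤k+2)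
  ... | inj₂ k≡u | _        = inj₂ (inj₂ (trans (cong suc (sym k≡u)) (sym v≡1+k)))
  ... | inj₁ _   | inj₂ u≡  = inj₂ (inj₁ (trans (cong suc v≡1+k) (sym u≡)))
  ... | inj₁ k<u | inj₁ u<  = inj₁ (toℕ-injective (trans (≤-antisym (s≤s⁻¹ u<) k<u) (sym v≡1+k)))

-- For the last node the interval of `interior-block` ends at `k + 2 = n`, one past the path;
-- trimming it leaves width 1.
last-block : (v : Fin n) → toℕ v ≡ suc k → n ≡ suc (suc k) → Block v k 1
last-block {k = k} v v≡1+k refl u = mk⇔ to from
  where
  module I = Equivalence (interior-block v v≡1+k u)
  to : Replaced P[ _ ] v u → k ≤ toℕ u × toℕ u ≤ k + 1
  to r = proj₁ (I.to r) , subst (toℕ u ≤_) (+-comm 1 k) (s≤s⁻¹ (toℕ<n u))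
  from : k ≤ toℕ u × toℕ u ≤ k + 1 → Replaced P[ _ ] v u
  from (k≤u , u≤k+1) = I.from (k≤u , ≤-trans u≤k+1 (+-monoʳ-≤ k (n≤1+n 1)))

-- The importance at each position

-- Both agglomerations have numerator 3, so what remains is a polynomial identity: `p / q` and
-- `m (m + 1) / (n (n + 1))` add up to 1.
IMC-block : ∀ {n m a w} (v : Fin n) → Block v a w → n ≡ m + w → a < m → 2 ≤ m →
            ∀ p q .{{_ : NonZero q}} →
            p * (n * suc n) + m * suc m * q ≡ q * (n * suc n) → IMC P[ n ] v ≡ + p / q
IMC-block {n@(suc _)} {m@(suc _)} {w = w} v block n≡m+w a<m 2≤m p q =
  1-/÷/ 3 (n * suc n) (m * suc m) p q {x = φ P[ n ]} {y = φ (contract P[ n ] v)}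
    {{φ≢0 (contract P[ n ] v)}}
    (≅P⇒φ ≅-refl (≤-trans 2≤m (subst (m ≤_) (sym n≡m+w) (m≤m+n m w))))
    (≅P⇒φ (contract-P≅P v n≡m+w a<m block) 2≤m)

IMC-end : ∀ {a} m (v : Fin (suc m)) → Block v a 1 → a < m → 2 ≤ m →
          IMC P[ suc m ] v ≡ + 2 / suc (suc m)
IMC-end m v block a<m 2≤m = IMC-block v block (+-comm 1 m) a<m 2≤m 2 (suc (suc m)) (identity m)
  where
  identity : ∀ m → 2 * (suc m * suc (suc m)) + m * suc m * suc (suc m) ≡
                   suc (suc m) * (suc m * suc (suc m))
  identity = solve-∀

IMC-interior : ∀ {a} m (v : Fin (suc (suc m))) → Block v a 2 → a < m → 2 ≤ m →
               IMC P[ suc (suc m) ] v ≡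
               + (2 * (2 * suc (suc m) ∸ 1)) / (suc (suc m) * suc (suc (suc m)))
IMC-interior m v block a<m 2≤m =
  IMC-block v block (+-comm 2 m) a<m 2≤m
    (2 * (2 * suc (suc m) ∸ 1)) (suc (suc m) * suc (suc (suc m))) identity
  where
  N : ℕ
  N = suc (suc m) * suc (suc (suc m))
  -- suc m + (suc (suc m) + 0) is what 2 * suc (suc m) ∸ 1 computes to.
  difference : ∀ m → 2 * (suc m + (suc (suc m) + 0)) + m * suc m ≡
                     suc (suc m) * suc (suc (suc m))
  difference = solve-∀
  -- The target denominator is `N = n (n + 1)` itself, so `N` factors out and 2(2n - 1) + (n - 2)(n
  -- - 1) = n(n + 1) is left.
  identity : 2 * (2 * suc (suc m) ∸ 1) * N + m * suc m * N ≡ N * N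
  identity = trans (sym (*-distribʳ-+ N (2 * (2 * suc (suc m) ∸ 1)) (m * suc m)))
                   (cong (λ x → x * N) (difference m))

-- With `n = m + 2`, the bound `n > 3` becomes `2 ≤ m`, so the contraction, of order `suc m` at an
-- end-node and `m` elsewhere, has at least two nodes. Recording the end-node status with each value
-- serves both halves of the theorem.
IMC-at : 2 ≤ m → {v : Fin (suc (suc m))} → Position v →
         (EndNode P[ suc (suc m) ] v × IMC P[ suc (suc m) ] v ≡ + 2 / suc (suc (suc m)))
         ⊎ (¬ EndNode P[ suc (suc m) ] v ×
            IMC P[ suc (suc m) ] v ≡
            + (2 * (2 * suc (suc m) ∸ 1)) / (suc (suc m) * suc (suc (suc m))))
IMC-at 2≤m {v} (first v≡) = inj₁
  (first-EndNode v v≡ , IMC-end _ v (first-block v v≡) z<s (m≤n⇒m≤1+n 2≤m))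
IMC-at 2≤m {v} (last v≡ refl) = inj₁
  (last-EndNode v v≡ refl , IMC-end _ v (last-block v v≡ refl) ≤-refl (m≤n⇒m≤1+n 2≤m))
IMC-at 2≤m {v} (interior v≡ 2+k<n) = inj₂
  (interior-¬EndNode v v≡ 2+k<n ,
   IMC-interior _ v (interior-block v v≡) (s≤s⁻¹ (s≤s⁻¹ 2+k<n)) 2≤m)

theorem2p1p1 : ∀ (n : ℕ) (n>3 : n > 3) (v : Fin n) →
    (EndNode P[ n ] v → IMC P[ n ] v ≡ + 2 / suc n)
    × (¬ EndNode P[ n ] v → IMC P[ n ] v ≡ (+ (2 * (2 * n ∸ 1)) / (n * suc n)) {{n[1+n]≢0 n>3}})
theorem2p1p1 (suc (suc m)) (s≤s (s≤s 2≤m)) v =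
  (λ end → [ proj₂ , contradiction end ∘ proj₁ ]′ at) ,
  λ ¬end → [ (λ p → contradiction (proj₁ p) ¬end) , proj₂ ]′ at
  where
  at = IMC-at 2≤m (position v)
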